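{- Let $\alpha, \beta, \gamma, a, b$ be integers such that $p = \alpha^2 a^2 + 2\beta a b + \gamma b^2$ is a prime number, and put $m = \alpha^2\gamma - \beta^2$. Then: (i) the conic $p x^2 - m y^2 = z^2$ has the rational point $(x,y,z) = (\alpha, b, \alpha^2 a + \beta b)$, and hence infinitely many rational points (pairwise non-proportional nonzero rational solutions $(x,y,z)$); (ii) if, in addition, $m$ is a prime with $m \equiv 1 \pmod 8$ and $\alpha$ is a prime with $\alpha \equiv 3 \pmod 4$, then the equation $p x^4 - m y^4 = z^2$ has no rational solutions other than $x=y=z=0$.
   Formalization: The claim of infinitely many rational points in (i) is stated for m ≠ 0; for m = 0 (e.g. α = β = 0, γ = p, b = 1) the equation p x² = z² has only the point (0:1:0), so the claim fails there. -}

module Defs where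

import Algebra.Definitions.RawSemiring
open import Data.Integer.Base as ℤ using (ℤ; +_)
import Data.Integer.Divisibility as ℤ
open import Data.Nat.Base using (ℕ)
open import Data.Nat.Primality using (Prime)
open import Data.Product.Base using (_×_; _,_; ∃-syntax; Σ-syntax)
open import Data.Rational.Base as ℚ using (ℚ; 0ℚ)
open import Relation.Binary.PropositionalEquality.Core using (_≡_; _≢_)
open import Relation.Nullary.Negation.Core using (¬_)

open Algebra.Definitions.RawSemiring ℚ.+-*-rawSemiring public using (_^_)

-- Prime numbers are positive, so -3 is excluded.
IsPrime : ℤ → Set
IsPrime i = ∃[ q ] Prime q × i ≡ + q

infix 4 _≡_[mod_]

_≡_[mod_] : ℤ → ℤ → ℤ → Set
i ≡ j [mod n ] = n ℤ.∣ i ℤ.- j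

fromℤ : ℤ → ℚ
fromℤ i = i ℚ./ 1

ℚ³ : Set
ℚ³ = ℚ × ℚ × ℚ

0ℚ³ : ℚ³
0ℚ³ = 0ℚ , 0ℚ , 0ℚ

infixr 7 _•_

_•_ : ℚ → ℚ³ → ℚ³
t • (x , y , z) = t ℚ.* x , t ℚ.* y , t ℚ.* z

Proportional : ℚ³ → ℚ³ → Set
Proportional P Q = ∃[ t ] t ≢ 0ℚ × P ≡ t • Q

ConicEquation : ℤ → ℤ → ℚ³ → Set
ConicEquation p m (x , y , z) = fromℤ p ℚ.* x ^ 2 ℚ.- fromℤ m ℚ.* y ^ 2 ≡ z ^ 2

-- Homogeneous coordinates of a rational point of the projective conic.
IsRationalPoint : ℤ → ℤ → ℚ³ → Set
IsRationalPoint p m P = P ≢ 0ℚ³ × ConicEquation p m P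

-- This fails for m = 0 and p prime: the form is then degenerate, and (0 , 1 , 0)
-- is the only point up to scaling. A genuine conic has m ≢ 0.
InfinitelyManyRationalPoints : ℤ → ℤ → Set
InfinitelyManyRationalPoints p m =
  Σ[ P ∈ (ℕ → ℚ³) ]
    (∀ n → IsRationalPoint p m (P n)) ×
    (∀ i j → i ≢ j → ¬ Proportional (P i) (P j))

QuarticEquation : ℤ → ℤ → ℚ³ → Set
QuarticEquation p m (x , y , z) = fromℤ p ℚ.* x ^ 4 ℚ.- fromℤ m ℚ.* y ^ 4 ≡ z ^ 2

{-# OPTIONS --safe #-}

-- Put A = α² a + β b, so that α² p = A² + m b².
--
-- (i) Since p is not a square, b ≠ 0, and multiplying A + α √p by (n + √p)² yields
-- infinitely many points on the conic Z² - p X² = - m Y².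
--
-- (ii) Let p x⁴ - m y⁴ = z² with x, y coprime and x ≠ 0, write (X , Y , Z) = (x² , y² , z),
-- and let L be the value at this point of the tangent form p α X - m b Y - A Z of the conic
-- at (α , b , A). Then 2 α X L and 2 b Y L are norms:
--   2 α X L = U² + m V²,   2 b Y L = W² - p V²   with V = α Y - b X, U = α Z - A X, W = b Z - A Y.
-- As m ≡ 1 (mod 8), the odd part of a norm U² + m V² is 1 mod 4. As α ≡ 3 (mod 4), the odd
-- part of L > 0 is therefore 3 mod 4, so some prime q ≡ 3 (mod 4) divides L to an odd power.
-- The product of L with L′, the tangent form at (α , b , - A), is p m V², which forces q to divide A,
-- hence p α² ≡ m b² (mod q), while q divides none of 2, α, b, x, y. The two norm equations make
-- - m and p squares modulo q; so - 1 is a square modulo q, which is impossible.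
module Submission where

open import Defs
open import Data.Empty using (⊥; ⊥-elim)
open import Data.Integer.Base using (ℤ; +_; -[1+_]; 0ℤ; 1ℤ; -1ℤ; _+_; _-_; _*_; -_; ∣_∣; NonZero; ≢-nonZero; _≤_; +≤+) renaming (_^_ to _^ℤ_)
open import Data.Integer.DivMod using (_%ℕ_; _/ℕ_; n%ℕd<d; a≡a%ℕn+[a/ℕn]*n)
open import Data.Integer.Divisibility.Signed
open import Data.Integer.Properties
open import Data.Integer.Tactic.RingSolver using (solve-∀)
open import Data.List.Base using ([]; _∷_)
open import Data.List.Relation.Unary.All using ([]; _∷_)
open import Data.Nat.Base as ℕ using (ℕ; zero; suc; z≤n; s≤s)
open import Data.Nat.Coprimality as Coprimality using (Coprime; coprime-Bézout; 1-coprimeTo)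
import Data.Nat.Divisibility as ℕ
open import Data.Nat.GCD using (gcd; gcd-greatest; gcd[m,n]∣m; gcd[m,n]∣n; gcd[m,n]≢0; module Bézout)
open import Data.Nat.Induction using (<-rec)
open import Data.Nat.ListAction using (product)
open import Data.Nat.Primality using (Prime; euclidsLemma; prime⇒irreducible; prime⇒nonZero; prime⇒nonTrivial; ¬prime[1]; prime[2])
open import Data.Nat.Primality.Factorisation using (PrimeFactorisation; factorise)
import Data.Nat.Properties as ℕ
open import Data.Product.Base using (∃-syntax; _×_; _,_; proj₁; proj₂)
open import Data.Rational.Base as ℚ using (ℚ; 0ℚ; mkℚ; ↥_; ↧_)
import Data.Rational.Properties as ℚ
open import Data.Rational.Solver using (module +-*-Solver)
import Data.Rational.Unnormalised.Base as ℚᵘ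
import Data.Rational.Unnormalised.Properties as ℚᵘ
open import Data.Sum.Base as Sum using (_⊎_; inj₁; inj₂; [_,_]′)
open import Function.Base using (id; _∘_)
open import Relation.Binary.Definitions using (tri<; tri≈; tri>)
open import Relation.Binary.PropositionalEquality
open import Relation.Nullary using (¬_; yes; no; contradiction)
open import Relation.Nullary.Decidable using (False; toWitnessFalse; from-no; decidable-stable)

-- Equations between polynomials are proved modulo a hypothesis e ≡ e′ by
-- exhibiting the cofactor k and leaving a ring identity.
modulo : ∀ {x y e e′} k → e ≡ e′ → x ≡ y + k * (e - e′) → x ≡ y
modulo {y = y} k e≡e′ x≡ = trans x≡ (trans
  (cong (λ t → y + k * t) (i≡j⇒i-j≡0 e≡e′))
  (trans (cong (_+_ y) (*-zeroʳ k)) (+-identityʳ y)))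

-- The implicit argument is settled by evaluation when `n`, `r`, `s` are numerals, so a use only has
-- to exhibit the two conflicting residues.
incongruent : ∀ n x y r s {_ : False (n ∣? (s - r))} → n * x + r ≢ n * y + s
incongruent n x y r s {n∤s-r} eq =
  toWitnessFalse n∤s-r (divides (x - y) (modulo (- 1ℤ) eq (lemma n x y r s)))
  where
  lemma : ∀ n x y r s → s - r ≡ (x - y) * n + - + 1 * ((n * x + r) - (n * y + s))
  lemma = solve-∀

-- Parity and odd squares

parity : ∀ i → (∃[ k ] i ≡ + 2 * k) ⊎ (∃[ k ] i ≡ + 2 * k + + 1)
parity i = go (i %ℕ 2) (n%ℕd<d i 2) (a≡a%ℕn+[a/ℕn]*n i 2)
  where
  lemma₀ : ∀ k → + 0 + k * + 2 ≡ + 2 * k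
  lemma₀ = solve-∀
  lemma₁ : ∀ k → + 1 + k * + 2 ≡ + 2 * k + + 1
  lemma₁ = solve-∀
  go : ∀ r → r ℕ.< 2 → i ≡ + r + (i /ℕ 2) * + 2 →
       (∃[ k ] i ≡ + 2 * k) ⊎ (∃[ k ] i ≡ + 2 * k + + 1)
  go 0 _ eq = inj₁ (i /ℕ 2 , trans eq (lemma₀ (i /ℕ 2)))
  go 1 _ eq = inj₂ (i /ℕ 2 , trans eq (lemma₁ (i /ℕ 2)))
  go (suc (suc _)) (ℕ.s≤s (ℕ.s≤s ()))

-- The square is 4k(k + 1) + 1, and one of k, k + 1 is even.
odd-square : ∀ k → ∃[ t ] (+ 2 * k + + 1) * (+ 2 * k + + 1) ≡ + 8 * t + + 1
odd-square k with parity k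
... | inj₁ (l , refl) = + 2 * (l * l) + l , lemma l
  where
  lemma : ∀ l → (+ 2 * (+ 2 * l) + + 1) * (+ 2 * (+ 2 * l) + + 1) ≡ + 8 * (+ 2 * (l * l) + l) + + 1
  lemma = solve-∀
... | inj₂ (l , refl) = + 2 * (l * l) + + 3 * l + + 1 , lemma l
  where
  lemma : ∀ l → (+ 2 * (+ 2 * l + + 1) + + 1) * (+ 2 * (+ 2 * l + + 1) + + 1) ≡
                + 8 * (+ 2 * (l * l) + + 3 * l + + 1) + + 1
  lemma = solve-∀

-- Odd parts modulo 4

-- For r = ±1: a power of two times a number congruent to `r` modulo 4, hence nonzero. The inductive
-- form lets proofs remove factors 2 by structural recursion.
data OddPart (r : ℤ) : ℤ → Set where
  base   : ∀ {n} → + 4 ∣ n - r → OddPart r n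
  double : ∀ {n} → OddPart r n → OddPart r (+ 2 * n)

OddPart-* : ∀ {r s a b} → OddPart r a → OddPart s b → OddPart (r * s) (a * b)
OddPart-* {r} {s} {a} {b} (base 4∣a-r) (base 4∣b-s) =
  base (subst (+ 4 ∣_) (lemma r s a b) (∣m∣n⇒∣m+n (∣m⇒∣m*n b 4∣a-r) (∣n⇒∣m*n r 4∣b-s)))
  where
  lemma : ∀ r s a b → (a - r) * b + r * (b - s) ≡ a * b - r * s
  lemma = solve-∀
OddPart-* {b = b} (double {a} h) k =
  subst (OddPart _) (sym (*-assoc (+ 2) a b)) (double (OddPart-* h k))
OddPart-* {a = a} h@(base _) (double {b} k) =
  subst (OddPart _) (lemma a b) (double (OddPart-* h k))
  where
  lemma : ∀ a b → + 2 * (a * b) ≡ a * (+ 2 * b)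
  lemma = solve-∀

OddPart-±1 : ∀ n → n ≢ 0ℤ → OddPart 1ℤ n ⊎ OddPart -1ℤ n
OddPart-±1 n = <-rec P step ∣ n ∣ n refl
  where
  P : ℕ → Set
  P k = ∀ n → ∣ n ∣ ≡ k → n ≢ 0ℤ → OddPart 1ℤ n ⊎ OddPart -1ℤ n
  lemma₁ : ∀ l → + 2 * (+ 2 * l) + + 1 - + 1 ≡ l * + 4
  lemma₁ = solve-∀
  lemma₃ : ∀ l → + 2 * (+ 2 * l + + 1) + + 1 - - + 1 ≡ (l + + 1) * + 4
  lemma₃ = solve-∀
  step : ∀ k → (∀ {j} → j ℕ.< k → P j) → P k
  step _ rec n refl n≢0 with parity n
  ... | inj₁ (h , refl) = Sum.map double double (rec ∣h∣<∣2h∣ h refl h≢0)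
    where
    h≢0 : h ≢ 0ℤ
    h≢0 refl = n≢0 refl
    instance _ = ≢-nonZero h≢0
    ∣h∣<∣2h∣ : ∣ h ∣ ℕ.< ∣ + 2 * h ∣
    ∣h∣<∣2h∣ = subst (∣ h ∣ ℕ.<_) (trans (ℕ.*-comm ∣ h ∣ 2) (sym (abs-* (+ 2) h)))
      (ℕ.m<m*n ∣ h ∣ 2 (ℕ.s≤s (ℕ.s≤s ℕ.z≤n)))
  ... | inj₂ (k , refl) with parity k
  ...   | inj₁ (l , refl) = inj₁ (base (divides l (lemma₁ l)))
  ...   | inj₂ (l , refl) = inj₂ (base (divides (l + + 1) (lemma₃ l)))

OddPart-square : ∀ {n} → n ≢ 0ℤ → OddPart 1ℤ (n * n)
OddPart-square {n} n≢0 with OddPart-±1 n n≢0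
... | inj₁ h = OddPart-* h h
... | inj₂ h = OddPart-* h h

-- The outcomes correspond to exactly one of `u`, `v` odd, both odd, both even. The last returns
-- four times a norm of the same shape, which allows a descent.
norm-mod-8 : ∀ μ u v → let s = u * u + (+ 8 * μ + + 1) * (v * v) in
             (∃[ t ] s ≡ + 4 * t + + 1) ⊎ (∃[ t ] s ≡ + 8 * t + + 2) ⊎
             (∃[ u′ ] ∃[ v′ ] s ≡ + 2 * (+ 2 * (u′ * u′ + (+ 8 * μ + + 1) * (v′ * v′))))
norm-mod-8 μ u v with parity u | parity v
... | inj₁ (k , refl) | inj₁ (l , refl) = inj₂ (inj₂ (k , l , lemma μ k l))
  where
  lemma : ∀ μ k l → + 2 * k * (+ 2 * k) + (+ 8 * μ + + 1) * (+ 2 * l * (+ 2 * l)) ≡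
                    + 2 * (+ 2 * (k * k + (+ 8 * μ + + 1) * (l * l)))
  lemma = solve-∀
... | inj₁ (k , refl) | inj₂ (l , refl) with t , eq ← odd-square l =
  inj₁ (k * k + + 2 * μ + + 16 * μ * t + + 2 * t ,
    trans (cong (λ o → + 2 * k * (+ 2 * k) + (+ 8 * μ + + 1) * o) eq) (lemma μ k t))
  where
  lemma : ∀ μ k t → + 2 * k * (+ 2 * k) + (+ 8 * μ + + 1) * (+ 8 * t + + 1) ≡
                    + 4 * (k * k + + 2 * μ + + 16 * μ * t + + 2 * t) + + 1
  lemma = solve-∀
... | inj₂ (k , refl) | inj₁ (l , refl) with t , eq ← odd-square k =
  inj₁ (+ 2 * t + (+ 8 * μ + + 1) * (l * l) ,
    trans (cong (λ o → o + (+ 8 * μ + + 1) * (+ 2 * l * (+ 2 * l))) eq) (lemma μ l t))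
  where
  lemma : ∀ μ l t → + 8 * t + + 1 + (+ 8 * μ + + 1) * (+ 2 * l * (+ 2 * l)) ≡
                    + 4 * (+ 2 * t + (+ 8 * μ + + 1) * (l * l)) + + 1
  lemma = solve-∀
... | inj₂ (k , refl) | inj₂ (l , refl) with t , eq ← odd-square k | w , eq′ ← odd-square l =
  inj₂ (inj₁ (t + μ + w + + 8 * μ * w ,
    trans (cong₂ (λ o o′ → o + (+ 8 * μ + + 1) * o′) eq eq′) (lemma μ t w)))
  where
  lemma : ∀ μ t w → + 8 * t + + 1 + (+ 8 * μ + + 1) * (+ 8 * w + + 1) ≡
                    + 8 * (t + μ + w + + 8 * μ * w) + + 2
  lemma = solve-∀

-- With odd part 3 modulo 4, `n` is 3 modulo 4, 6 modulo 8, or divisible by 4. The first two do not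
-- occur in `norm-mod-8`; in the last, `u` and `v` are even, and dividing by 4 leaves a norm with a
-- shorter derivation.
norm-OddPart : ∀ {n} μ u v → n ≡ u * u + (+ 8 * μ + + 1) * (v * v) → ¬ OddPart -1ℤ n
norm-OddPart {n} μ u v eq (base (divides c 4c)) = go (norm-mod-8 μ u v)
  where
  lemma : ∀ c n → n ≡ + 4 * c + - + 1 + + 1 * ((n - - + 1) - c * + 4)
  lemma = solve-∀
  n≡4c-1 : n ≡ + 4 * c + - + 1
  n≡4c-1 = modulo (+ 1) 4c (lemma c n)
  lemma₂ : ∀ t → + 8 * t + + 2 ≡ + 4 * (+ 2 * t) + + 2
  lemma₂ = solve-∀
  lemma₃ : ∀ t → + 2 * (+ 2 * t) ≡ + 4 * t + + 0
  lemma₃ = solve-∀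
  go : _ → ⊥
  go (inj₁ (t , s≡)) = incongruent (+ 4) t c (+ 1) (- + 1) (trans (sym (trans eq s≡)) n≡4c-1)
  go (inj₂ (inj₁ (t , s≡))) =
    incongruent (+ 4) (+ 2 * t) c (+ 2) (- + 1)
      (trans (sym (trans eq (trans s≡ (lemma₂ t)))) n≡4c-1)
  go (inj₂ (inj₂ (u′ , v′ , s≡))) =
    incongruent (+ 4) (u′ * u′ + (+ 8 * μ + + 1) * (v′ * v′)) c (+ 0) (- + 1)
      (trans (sym (trans eq (trans s≡ (lemma₃ (u′ * u′ + (+ 8 * μ + + 1) * (v′ * v′)))))) n≡4c-1)
norm-OddPart μ u v eq (double {k} (base (divides c 4c))) = go (norm-mod-8 μ u v)
  where
  lemma : ∀ c k → + 2 * k ≡ + 4 * (+ 2 * c) + - + 2 + + 2 * ((k - - + 1) - c * + 4)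
  lemma = solve-∀
  lemma₈ : ∀ c → + 4 * (+ 2 * c) + - + 2 ≡ + 8 * c + - + 2
  lemma₈ = solve-∀
  2k≡ : + 2 * k ≡ + 4 * (+ 2 * c) + - + 2
  2k≡ = modulo (+ 2) 4c (lemma c k)
  lemma₃ : ∀ t → + 2 * (+ 2 * t) ≡ + 4 * t + + 0
  lemma₃ = solve-∀
  go : _ → ⊥
  go (inj₁ (t , s≡)) = incongruent (+ 4) t (+ 2 * c) (+ 1) (- + 2) (trans (sym (trans eq s≡)) 2k≡)
  go (inj₂ (inj₁ (t , s≡))) =
    -- Modulo 4 the residues 2 and -2 coincide, so the comparison is made modulo 8. For m ≡ 5 (mod
    -- 8) it would fail, as 1 + 5 = 6.
    incongruent (+ 8) t c (+ 2) (- + 2) (trans (sym (trans eq s≡)) (trans 2k≡ (lemma₈ c)))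
  go (inj₂ (inj₂ (u′ , v′ , s≡))) =
    incongruent (+ 4) (u′ * u′ + (+ 8 * μ + + 1) * (v′ * v′)) (+ 2 * c) (+ 0) (- + 2)
      (trans (sym (trans eq (trans s≡ (lemma₃ (u′ * u′ + (+ 8 * μ + + 1) * (v′ * v′)))))) 2k≡)
norm-OddPart μ u v eq (double (double {k} h)) = go (norm-mod-8 μ u v)
  where
  lemma₀ : ∀ k → + 2 * (+ 2 * k) ≡ + 4 * k + + 0
  lemma₀ = solve-∀
  lemma₂ : ∀ t → + 8 * t + + 2 ≡ + 4 * (+ 2 * t) + + 2
  lemma₂ = solve-∀
  go : _ → ⊥
  go (inj₁ (t , s≡)) = incongruent (+ 4) t k (+ 1) (+ 0) (trans (sym (trans eq s≡)) (lemma₀ k))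
  go (inj₂ (inj₁ (t , s≡))) =
    incongruent (+ 4) (+ 2 * t) k (+ 2) (+ 0)
      (trans (sym (trans eq (trans s≡ (lemma₂ t)))) (lemma₀ k))
  go (inj₂ (inj₂ (u′ , v′ , s≡))) =
    norm-OddPart μ u′ v′
      (*-cancelˡ-≡ (+ 2) _ _ (*-cancelˡ-≡ (+ 2) _ _ (trans eq s≡))) h

-- Divisibility and quadratic residues modulo a prime

modulo₂ : ∀ {x y e e′ f f′} k l → e ≡ e′ → f ≡ f′ →
          x ≡ y + k * (e - e′) + l * (f - f′) → x ≡ y
modulo₂ k l e≡e′ f≡f′ x≡ = modulo k e≡e′ (modulo l f≡f′ x≡)

∣-combine : ∀ {d a b c} s t → d ∣ a → d ∣ b → c ≡ s * a + t * b → d ∣ c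
∣-combine s t d∣a d∣b refl = ∣m∣n⇒∣m+n (∣n⇒∣m*n s d∣a) (∣n⇒∣m*n t d∣b)

-- Descent: the root may be chosen even and below n, and then the cofactor of n in
-- s² + 1 is smaller than n and again congruent to 3 modulo 4.
-1-nonresidue : ∀ n → + 4 ∣ + n + + 1 → ∀ s → ¬ + n ∣ s * s + + 1
-1-nonresidue = <-rec P step
  where
  P : ℕ → Set
  P n = + 4 ∣ + n + + 1 → ∀ s → ¬ + n ∣ s * s + + 1
  step : ∀ n → (∀ {k} → k ℕ.< n → P k) → P n
  step zero rec 4∣1 = contradiction 4∣1 (from-no (+ 4 ∣? + 1))
  step n@(suc n-1) rec 4∣n+1@(divides c n+1≡4c) s n∣s²+1 = go r r<n n∣r²+1 (parity (+ r))
    where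
    r : ℕ
    r = s %ℕ n
    r<n : r ℕ.< n
    r<n = n%ℕd<d s n
    n∣r²+1 : + n ∣ + r * + r + + 1
    n∣r²+1 = ∣-combine (+ 1) (- (s + + r)) n∣s²+1
      (divides (s /ℕ n) (modulo (+ 1) (a≡a%ℕn+[a/ℕn]*n s n) (lemma s (+ r) (s /ℕ n * + n))))
      (lemma′ s (+ r))
      where
      lemma : ∀ s r t → s - r ≡ t + + 1 * (s - (r + t))
      lemma = solve-∀
      lemma′ : ∀ s r → r * r + + 1 ≡ + 1 * (s * s + + 1) + - (s + r) * (s - r)
      lemma′ = solve-∀
    descend : ∀ r u → r ℕ.< n → + r ≡ + 2 * u → + n ∣ + r * + r + + 1 → ⊥
    descend r u r<n r≡2u n∣ with ∣⇒∣ᵤ (subst (λ t → + n ∣ t + + 1) (sym (pos-* r r)) n∣)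
    ... | ℕ.divides k r²+1≡kn =
      rec (k<n r r<n r²+1≡kn)
        -- With n = 4c - 1, the equation 4u² + 1 = kn reads k + 1 = 4(ck - u²), so again k ≡ 3 (mod
        -- 4).
        (divides (c * + k - u * u) (modulo₂ (+ 1) (+ k) 4u²+1≡kn n+1≡4c (lemma (+ k) c u (+ n))))
        (+ 2 * u) (divides (+ n) (trans 4u²+1≡kn (*-comm (+ k) (+ n))))
      where
      4u²+1≡kn : + 2 * u * (+ 2 * u) + + 1 ≡ + k * + n
      4u²+1≡kn = subst (λ t → t * t + + 1 ≡ + k * + n) r≡2u
        (trans (cong (_+ + 1) (sym (pos-* r r))) (trans (cong +_ r²+1≡kn) (pos-* k n)))
      lemma : ∀ k c u n → k + + 1 ≡ (c * k - u * u) * + 4 +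
                          + 1 * (+ 2 * u * (+ 2 * u) + + 1 - k * n) + k * (n + + 1 - c * + 4)
      lemma = solve-∀
      k<n : ∀ r → r ℕ.< n → r ℕ.* r ℕ.+ 1 ≡ k ℕ.* n → k ℕ.< n
      -- For r = 0 the number `n` divides 1, but 1 is not 3 modulo 4.
      k<n zero _ 1≡kn with refl ← ℕ.∣1⇒≡1 (ℕ.divides k 1≡kn) =
        contradiction 4∣n+1 (from-no (+ 4 ∣? + 2))
      k<n r@(suc _) r<n r²+1≡kn = ℕ.*-cancelʳ-< n k n (begin-strict
        k ℕ.* n          ≡⟨ r²+1≡kn ⟨
        r ℕ.* r ℕ.+ 1    ≤⟨ ℕ.+-monoʳ-≤ (r ℕ.* r) (s≤s z≤n) ⟩
        r ℕ.* r ℕ.+ r    ≡⟨ ℕ.+-comm (r ℕ.* r) r ⟩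
        r ℕ.+ r ℕ.* r    ≡⟨ ℕ.*-suc r r ⟨
        r ℕ.* suc r      ≤⟨ ℕ.*-monoʳ-≤ r r<n ⟩
        r ℕ.* n          <⟨ ℕ.*-monoˡ-< n r<n ⟩
        n ℕ.* n          ∎)
        where open ℕ.≤-Reasoning
    go : ∀ r → r ℕ.< n → + n ∣ + r * + r + + 1 → (∃[ k ] + r ≡ + 2 * k) ⊎ (∃[ k ] + r ≡ + 2 * k + + 1) → ⊥
    go r r<n n∣ (inj₁ (u , r≡2u)) = descend r u r<n r≡2u n∣
    go zero r<n n∣ (inj₂ (u , 0≡2u+1)) = incongruent (+ 2) (+ 0) u (+ 0) (+ 1) 0≡2u+1
    go r@(suc r-1) r<n n∣ (inj₂ (u , r≡2u+1)) =
      -- As n = 4c - 1 is odd, n - r is even, namely 2(2c - u - 1), and its square is r² modulo `n`.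
      descend (n ℕ.∸ r) (+ 2 * c - u - + 1) (s≤s (ℕ.m∸n≤m n-1 r-1))
        (trans n-r≡ (modulo₂ (+ 1) (- + 1) n+1≡4c r≡2u+1 (lemma c u (+ n) (+ r))))
        (subst (λ t → + n ∣ t * t + + 1) (sym n-r≡)
          (∣-combine (+ 1) (+ n - + 2 * + r) n∣ ∣-refl (lemma′ (+ n) (+ r))))
      where
      n-r≡ : + (n ℕ.∸ r) ≡ + n - + r
      n-r≡ = sym (trans ([+m]-[+n]≡m⊖n n r) (⊖-≥ (ℕ.<⇒≤ r<n)))
      lemma : ∀ c u n r → n - r ≡ + 2 * (+ 2 * c - u - + 1) +
                          + 1 * (n + + 1 - c * + 4) + - + 1 * (r - (+ 2 * u + + 1))
      lemma = solve-∀
      lemma′ : ∀ n r → (n - r) * (n - r) + + 1 ≡ + 1 * (r * r + + 1) + (n - + 2 * r) * n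
      lemma′ = solve-∀

euclid : ∀ {q} → Prime q → ∀ i j → + q ∣ i * j → (+ q ∣ i) ⊎ (+ q ∣ j)
euclid {q} q-prime i j q∣ij = Sum.map ∣ᵤ⇒∣ ∣ᵤ⇒∣
  (euclidsLemma ∣ i ∣ ∣ j ∣ q-prime (subst (q ℕ.∣_) (abs-* i j) (∣⇒∣ᵤ q∣ij)))

∤-* : ∀ {q} → Prime q → ∀ {i j} → ¬ + q ∣ i → ¬ + q ∣ j → ¬ + q ∣ i * j
∤-* q-prime q∤i q∤j = [ q∤i , q∤j ]′ ∘ euclid q-prime _ _

∣-square : ∀ {q} → Prime q → ∀ i → + q ∣ i * i → + q ∣ i
∣-square q-prime i = [ id , id ]′ ∘ euclid q-prime i i

prime-∣-prime : ∀ {q r} → Prime q → Prime r → + q ∣ + r → q ≡ r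
prime-∣-prime q-prime r-prime q∣r with prime⇒irreducible r-prime (∣⇒∣ᵤ q∣r)
... | inj₁ refl = contradiction q-prime ¬prime[1]
... | inj₂ q≡r  = q≡r

prime-inverse : ∀ {q} → Prime q → ∀ {t} → ¬ + q ∣ t → ∃[ u ] + q ∣ t * u - + 1
prime-inverse {q} q-prime {t} q∤t = go (+∣i∣≡i⊎+∣i∣≡-i t)
  where
  coprime : Coprime q ∣ t ∣
  coprime (d∣q , d∣t) with prime⇒irreducible q-prime d∣q
  ... | inj₁ d≡1  = d≡1
  ... | inj₂ refl = contradiction (∣ᵤ⇒∣ d∣t) q∤t
  cast : ∀ x y z w → 1 ℕ.+ x ℕ.* y ≡ z ℕ.* w → + 1 + + x * + y ≡ + z * + w
  cast x y z w eq =
    trans (cong (_+_ (+ 1)) (sym (pos-* x y))) (trans (cong +_ eq) (pos-* z w))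
  inverse-∣t∣ : ∃[ u ] + q ∣ + ∣ t ∣ * u - + 1
  inverse-∣t∣ with coprime-Bézout coprime
  ... | Bézout.+- x y eq = - + y , divides (- + x)
    (modulo (- + 1) (cast y ∣ t ∣ x q eq) (lemma (+ x) (+ y) (+ ∣ t ∣) (+ q)))
    where
    lemma : ∀ x y t q → t * (- y) - + 1 ≡ - x * q + - + 1 * (+ 1 + y * t - x * q)
    lemma = solve-∀
  ... | Bézout.-+ x y eq = + y , divides (+ x)
    (modulo (- + 1) (cast x q y ∣ t ∣ eq) (lemma (+ x) (+ y) (+ ∣ t ∣) (+ q)))
    where
    lemma : ∀ x y t q → t * y - + 1 ≡ x * q + - + 1 * (+ 1 + x * q - y * t)
    lemma = solve-∀
  go : + ∣ t ∣ ≡ t ⊎ + ∣ t ∣ ≡ - t → ∃[ u ] + q ∣ t * u - + 1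
  go (inj₁ eq) = subst (λ s → ∃[ u ] + q ∣ s * u - + 1) eq inverse-∣t∣
  go (inj₂ eq) with u , h ← inverse-∣t∣ = - u ,
    subst (+ q ∣_) (trans (cong (λ s → s * u - + 1) eq) (lemma t u)) h
    where
    lemma : ∀ t u → - t * u - + 1 ≡ t * - u - + 1
    lemma = solve-∀

-- If `q` did not divide `t`, multiplying by the square of an inverse of `t` would make -1 a square
-- modulo `q`.
prime-∣-sum-of-squares : ∀ {q} → Prime q → + 4 ∣ + q + + 1 → ∀ s t → + q ∣ s * s + t * t → + q ∣ t
prime-∣-sum-of-squares {q} q-prime 4∣q+1 s t q∣ with + q ∣? t
... | yes q∣t = q∣t
... | no  q∤t with u , q∣tu-1 ← prime-inverse q-prime q∤t =
  contradiction (∣-combine (u * u) (- (t * u + + 1)) q∣ q∣tu-1 (lemma s t u))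
    (-1-nonresidue q 4∣q+1 (s * u))
  where
  lemma : ∀ s t u → s * u * (s * u) + + 1 ≡ u * u * (s * s + t * t) + - (t * u + + 1) * (t * u - + 1)
  lemma = solve-∀

-- Primes of odd valuation

-- Factors `q` are removed in pairs until exactly one is left. This matches the descents below,
-- which divide square roots by `q` and hence the equation by q².
data OddValuation (q : ℕ) : ℤ → Set where
  once       : ∀ {n} → ¬ + q ∣ n → OddValuation q (+ q * n)
  twice-more : ∀ {n} → OddValuation q n → OddValuation q (+ q * (+ q * n))

OddValuation-∣ : ∀ {q n} → OddValuation q n → + q ∣ n
OddValuation-∣ {q} (once {n} _) = ∣m⇒∣m*n n ∣-refl
OddValuation-∣ {q} (twice-more {n} _) = ∣m⇒∣m*n (+ q * n) ∣-refl

OddValuation-* : ∀ {q} → Prime q → ∀ {c n} → ¬ + q ∣ c → OddValuation q n → OddValuation q (c * n)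
OddValuation-* {q} q-prime {c} q∤c (once {n} q∤n) =
  subst (OddValuation q) (lemma (+ q) c n) (once (∤-* q-prime q∤c q∤n))
  where
  lemma : ∀ q c n → q * (c * n) ≡ c * (q * n)
  lemma = solve-∀
OddValuation-* {q} q-prime {c} q∤c (twice-more {n} h) =
  subst (OddValuation q) (lemma (+ q) c n) (twice-more (OddValuation-* q-prime q∤c h))
  where
  lemma : ∀ q c n → q * (q * (c * n)) ≡ c * (q * (q * n))
  lemma = solve-∀

∣-norm : ∀ {q} → Prime q → ∀ d u {v} → + q ∣ u * u + d * (v * v) → + q ∣ v → + q ∣ u
∣-norm q-prime d u {v} q∣norm q∣v =
  ∣-square q-prime u (∣-combine (+ 1) (- (d * v)) q∣norm q∣v (lemma d u v))
  where
  lemma : ∀ d u v → u * u ≡ + 1 * (u * u + d * (v * v)) + - (d * v) * v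
  lemma = solve-∀

-- A common factor `q` of `u` and `v` takes q² out of `n` and leaves its valuation odd; in the case
-- `once` there is no q² to take. So the descent stops at some `v′` prime to `q`, and -d is a square
-- modulo `q`.
norm-residue : ∀ {q} → Prime q → ∀ d u v {n} → OddValuation q n → n ≡ u * u + d * (v * v) →
               ∃[ u′ ] ∃[ v′ ] (¬ + q ∣ v′) × (+ q ∣ u′ * u′ + d * (v′ * v′))
norm-residue {q} q-prime d = go
  where
  instance _ = prime⇒nonZero q-prime
  lemma : ∀ x d y q → x * q * (x * q) + d * (y * q * (y * q)) ≡ q * ((x * x + d * (y * y)) * q)
  lemma = solve-∀
  lemma′ : ∀ x d y q → x * q * (x * q) + d * (y * q * (y * q)) ≡ q * (q * (x * x + d * (y * y)))
  lemma′ = solve-∀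
  go : ∀ u v {n} → OddValuation q n → n ≡ u * u + d * (v * v) →
       ∃[ u′ ] ∃[ v′ ] (¬ + q ∣ v′) × (+ q ∣ u′ * u′ + d * (v′ * v′))
  descend : ∀ {u v n} → OddValuation q n → n ≡ u * u + d * (v * v) → + q ∣ u → + q ∣ v →
            ∃[ u′ ] ∃[ v′ ] (¬ + q ∣ v′) × (+ q ∣ u′ * u′ + d * (v′ * v′))
  go u v h n≡ with + q ∣? v
  ... | no  q∤v = u , v , q∤v , subst (+ q ∣_) n≡ (OddValuation-∣ h)
  ... | yes q∣v = descend h n≡ (∣-norm q-prime d u (subst (+ q ∣_) n≡ (OddValuation-∣ h)) q∣v) q∣v
  descend (once q∤w) eq (divides x refl) (divides y refl) = contradiction
    (divides (x * x + d * (y * y)) (*-cancelˡ-≡ (+ q) _ _ (trans eq (lemma x d y (+ q))))) q∤w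
  descend (twice-more h) eq (divides x refl) (divides y refl) = go x y h
    (*-cancelˡ-≡ (+ q) _ _ (*-cancelˡ-≡ (+ q) _ _ (trans eq (lemma′ x d y (+ q)))))

-- The right-hand side is 0 or has even valuation at `q`, so `k` must supply a further factor. The
-- proof cancels q² on both sides until `n` has a single factor `q` left.
OddValuation-cofactor : ∀ {q} → Prime q → ∀ {c} → ¬ + q ∣ c → ∀ k v {n} → OddValuation q n →
                        n * k ≡ c * (v * v) → + q ∣ k
OddValuation-cofactor {q} q-prime {c} q∤c k v h eq
  with divides y refl ← ∣-square q-prime v
         ([ (λ q∣c → contradiction q∣c q∤c) , id ]′
           (euclid q-prime c (v * v) (subst (+ q ∣_) eq (∣m⇒∣m*n k (OddValuation-∣ h)))))
  = go h eq
  where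
  instance _ = prime⇒nonZero q-prime
  lemma : ∀ c y q → c * (y * q * (y * q)) ≡ q * ((c * (y * y)) * q)
  lemma = solve-∀
  lemma′ : ∀ c y q → c * (y * q * (y * q)) ≡ q * (q * (c * (y * y)))
  lemma′ = solve-∀
  go : ∀ {n} → OddValuation q n → n * k ≡ c * (y * + q * (y * + q)) → + q ∣ k
  go (once {w} q∤w) eq = [ (λ q∣w → contradiction q∣w q∤w) , id ]′ (euclid q-prime w k
    (divides (c * (y * y)) (*-cancelˡ-≡ (+ q) _ _
      (trans (sym (*-assoc (+ q) w k)) (trans eq (lemma c y (+ q)))))))
  go (twice-more {n} h) eq = OddValuation-cofactor q-prime q∤c k y h
    (*-cancelˡ-≡ (+ q) _ _ (*-cancelˡ-≡ (+ q) _ _ (trans (lemma″ (+ q) n k) (trans eq (lemma′ c y (+ q))))))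
    where
    lemma″ : ∀ q n k → q * (q * (n * k)) ≡ q * (q * n) * k
    lemma″ = solve-∀

-- The prime 2 belongs to the first alternative, its odd part being 1.
prime-mod-4 : ∀ {q} → Prime q → OddPart 1ℤ (+ q) ⊎ (+ 4 ∣ + q + + 1)
prime-mod-4 {q} q-prime with parity (+ q)
... | inj₁ (k , q≡2k)
    with refl ← prime-∣-prime prime[2] q-prime (divides k (trans q≡2k (*-comm (+ 2) k)))
    = inj₁ (double (base {n = + 1} (divides 0ℤ refl)))
... | inj₂ (k , q≡2k+1) with parity k
...   | inj₁ (l , refl) = inj₁ (subst (OddPart 1ℤ) (sym q≡2k+1) (base (divides l (lemma l))))
  where
  lemma : ∀ l → + 2 * (+ 2 * l) + + 1 - + 1 ≡ l * + 4
  lemma = solve-∀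
...   | inj₂ (l , refl) = inj₂ (divides (l + + 1) (trans (cong (_+ + 1) q≡2k+1) (lemma l)))
  where
  lemma : ∀ l → + 2 * (+ 2 * l + + 1) + + 1 + + 1 ≡ (l + + 1) * + 4
  lemma = solve-∀

OddPart-1⇒≢3 : ∀ {n} → OddPart 1ℤ n → ¬ + 4 ∣ n + + 1
OddPart-1⇒≢3 (base {n} 4∣n-1) 4∣n+1 =
  contradiction (∣-combine (+ 1) (- + 1) 4∣n+1 4∣n-1 (lemma n)) (from-no (+ 4 ∣? + 2))
  where
  lemma : ∀ n → + 2 ≡ + 1 * (n + + 1) + - + 1 * (n - + 1)
  lemma = solve-∀
OddPart-1⇒≢3 (double {n} _) (divides c 2n+1≡4c) =
  incongruent (+ 2) n (+ 2 * c) (+ 1) (+ 0) (trans 2n+1≡4c (lemma c))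
  where
  lemma : ∀ c → c * + 4 ≡ + 2 * (+ 2 * c) + + 0
  lemma = solve-∀

-- If all primes congruent to 3 modulo 4 have even valuation, the odd part is a product of squares
-- and of primes that are 1 modulo 4. The induction takes out one prime factor at a time.
odd-valuation-prime : ∀ l → l ≢ 0 → OddPart 1ℤ (+ l) ⊎
                      (∃[ q ] Prime q × (+ 4 ∣ + q + + 1) × OddValuation q (+ l))
odd-valuation-prime = <-rec P step
  where
  P : ℕ → Set
  P l = l ≢ 0 → OddPart 1ℤ (+ l) ⊎ (∃[ q ] Prime q × (+ 4 ∣ + q + + 1) × OddValuation q (+ l))
  peel : ∀ p l → Prime p → (∀ {k} → k ℕ.< p ℕ.* l → P k) → P (p ℕ.* l)
  peel p l p-prime rec pl≢0 with prime-mod-4 p-prime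
  ... | inj₁ p-good = Sum.map
      (subst (OddPart 1ℤ) (sym (pos-* p l)) ∘ OddPart-* p-good)
      (λ (q , q-prime , 4∣q+1 , h) → q , q-prime , 4∣q+1 ,
        subst (OddValuation q) (sym (pos-* p l)) (OddValuation-* q-prime (q∤p q-prime 4∣q+1) h))
      (rec l<pl l≢0)
    where
    l≢0 : l ≢ 0
    l≢0 refl = pl≢0 (ℕ.*-zeroʳ p)
    instance _ = ℕ.≢-nonZero l≢0
    l<pl : l ℕ.< p ℕ.* l
    l<pl = subst (l ℕ.<_) (ℕ.*-comm l p) (ℕ.m<m*n l p (ℕ.nonTrivial⇒n>1 p {{prime⇒nonTrivial p-prime}}))
    q∤p : ∀ {q} → Prime q → + 4 ∣ + q + + 1 → ¬ + q ∣ + p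
    q∤p q-prime 4∣q+1 q∣p with refl ← prime-∣-prime q-prime p-prime q∣p = OddPart-1⇒≢3 p-good 4∣q+1
  -- Here p ≡ 3 (mod 4). Either `p` occurs just once and is the prime sought, or p² is removed,
  -- which changes neither the odd part modulo 4 nor the parity of any valuation.
  ... | inj₂ 4∣p+1 with + p ∣? + l
  ...   | no p∤l = inj₂ (p , p-prime , 4∣p+1 , subst (OddValuation p) (sym (pos-* p l)) (once p∤l))
  ...   | yes p∣l with ℕ.divides k refl ← ∣⇒∣ᵤ p∣l =
      Sum.map
        (λ h → subst (OddPart 1ℤ) (sym ppk≡) (OddPart-* p-OddPart (OddPart-* p-OddPart h)))
        (λ (q , q-prime , 4∣q+1 , h) → q , q-prime , 4∣q+1 ,
          subst (OddValuation q) (sym ppk≡) (lift q-prime h))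
        (rec k<pkp k≢0)
    where
    p-OddPart : OddPart -1ℤ (+ p)
    p-OddPart = base 4∣p+1
    ppk≡ : + (p ℕ.* (k ℕ.* p)) ≡ + p * (+ p * + k)
    ppk≡ = trans (pos-* p (k ℕ.* p)) (cong (+ p *_) (trans (cong +_ (ℕ.*-comm k p)) (pos-* p k)))
    k≢0 : k ≢ 0
    k≢0 refl = pl≢0 (ℕ.*-zeroʳ p)
    instance
      _ = ℕ.≢-nonZero k≢0
      _ = prime⇒nonZero p-prime
    k<pkp : k ℕ.< p ℕ.* (k ℕ.* p)
    k<pkp = ℕ.<-≤-trans (ℕ.m<m*n k p (ℕ.nonTrivial⇒n>1 p {{prime⇒nonTrivial p-prime}})) (ℕ.m≤n*m (k ℕ.* p) p)
    lift : ∀ {q} → Prime q → OddValuation q (+ k) → OddValuation q (+ p * (+ p * + k))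
    lift {q} q-prime h with q ℕ.≟ p
    ... | yes refl = twice-more h
    ... | no  q≢p  = OddValuation-* q-prime q∤p (OddValuation-* q-prime q∤p h)
      where
      q∤p : ¬ + q ∣ + p
      q∤p = q≢p ∘ prime-∣-prime q-prime p-prime
  step : ∀ l → (∀ {k} → k ℕ.< l → P k) → P l
  step l rec l≢0 with factorise l {{ℕ.≢-nonZero l≢0}}
  ... | record { factors = [] ; isFactorisation = refl } = inj₁ (base (divides 0ℤ refl))
  ... | record { factors = p ∷ ps ; isFactorisation = refl ; factorsPrime = p-prime ∷ _ } =
    peel p (product ps) p-prime rec l≢0

-- Positivity of integral norms

square≡+ : ∀ i → i * i ≡ + (∣ i ∣ ℕ.* ∣ i ∣)
square≡+ (+ n)    = sym (pos-* n n)
square≡+ -[1+ n ] = refl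

square≡0⇒≡0 : ∀ i → i * i ≡ 0ℤ → i ≡ 0ℤ
square≡0⇒≡0 i = [ id , id ]′ ∘ i*j≡0⇒i≡0∨j≡0 i

norm≡+ : ∀ m u v → u * u + + m * (v * v) ≡ + (∣ u ∣ ℕ.* ∣ u ∣ ℕ.+ m ℕ.* (∣ v ∣ ℕ.* ∣ v ∣))
norm≡+ m u v = cong₂ _+_ (square≡+ u) (trans (cong (+ m *_) (square≡+ v)) (sym (pos-* m _)))

norm≡0⇒≡0 : ∀ m .{{_ : ℕ.NonZero m}} u v → u * u + + m * (v * v) ≡ 0ℤ → u ≡ 0ℤ × v ≡ 0ℤ
norm≡0⇒≡0 m u v eq =
    root (ℕ.m+n≡0⇒m≡0 _ sum≡0)
  , root (ℕ.m*n≡0⇒m≡0 _ m (trans (ℕ.*-comm _ m) (ℕ.m+n≡0⇒n≡0 (∣ u ∣ ℕ.* ∣ u ∣) sum≡0)))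
  where
  sum≡0 : ∣ u ∣ ℕ.* ∣ u ∣ ℕ.+ m ℕ.* (∣ v ∣ ℕ.* ∣ v ∣) ≡ 0
  sum≡0 = +-injective (trans (sym (norm≡+ m u v)) eq)
  root : ∀ {i} → ∣ i ∣ ℕ.* ∣ i ∣ ≡ 0 → i ≡ 0ℤ
  root {i} eq = square≡0⇒≡0 i (trans (square≡+ i) (cong +_ eq))

odd-valuation-prime⁺ : ∀ {n} → 0ℤ ≤ n → n ≢ 0ℤ →
                       OddPart 1ℤ n ⊎ (∃[ q ] Prime q × (+ 4 ∣ + q + + 1) × OddValuation q n)
odd-valuation-prime⁺ {+ l} _ l≢0 = odd-valuation-prime l (λ l≡0 → l≢0 (cong +_ l≡0))

-- Tangents of the conic p X² - m Y² = Z²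

tangent : (p m α b A X Y Z : ℤ) → ℤ
tangent p m α b A X Y Z = p * α * X - m * b * Y - A * Z

-- Half of 2pα²X² is rewritten by each equation, as X²(A² + mb²) and α²(Z² + mY²); the remaining
-- terms complete the squares.
tangent-norm₁ : ∀ p m α b A X Y Z → p * (α * α) ≡ A * A + m * (b * b) → p * (X * X) ≡ Z * Z + m * (Y * Y) →
                + 2 * α * X * tangent p m α b A X Y Z ≡
                (α * Z - A * X) * (α * Z - A * X) + m * ((α * Y - b * X) * (α * Y - b * X))
tangent-norm₁ p m α b A X Y Z e f = modulo₂ (X * X) (α * α) e f (lemma p m α b A X Y Z)
  where
  lemma : ∀ p m α b A X Y Z → + 2 * α * X * (p * α * X - m * b * Y - A * Z) ≡
          (α * Z - A * X) * (α * Z - A * X) + m * ((α * Y - b * X) * (α * Y - b * X)) +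
          X * X * (p * (α * α) - (A * A + m * (b * b))) + α * α * (p * (X * X) - (Z * Z + m * (Y * Y)))
  lemma = solve-∀

-- Here -2mb²Y² is split in the same way, into Y²(A² - pα²) and b²(Z² - pX²).
tangent-norm₂ : ∀ p m α b A X Y Z → p * (α * α) ≡ A * A + m * (b * b) → p * (X * X) ≡ Z * Z + m * (Y * Y) →
                + 2 * b * Y * tangent p m α b A X Y Z ≡
                (b * Z - A * Y) * (b * Z - A * Y) + - p * ((α * Y - b * X) * (α * Y - b * X))
tangent-norm₂ p m α b A X Y Z e f = modulo₂ (Y * Y) (b * b) e f (lemma p m α b A X Y Z)
  where
  lemma : ∀ p m α b A X Y Z → + 2 * b * Y * (p * α * X - m * b * Y - A * Z) ≡
          (b * Z - A * Y) * (b * Z - A * Y) + - p * ((α * Y - b * X) * (α * Y - b * X)) +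
          Y * Y * (p * (α * α) - (A * A + m * (b * b))) + b * b * (p * (X * X) - (Z * Z + m * (Y * Y)))
  lemma = solve-∀

-- The product is (pαX - mbY)² - A²Z². Substituting for A² and Z² leaves the right-hand side by
-- Brahmagupta's identity.
tangent-product : ∀ p m α b A X Y Z → p * (α * α) ≡ A * A + m * (b * b) → p * (X * X) ≡ Z * Z + m * (Y * Y) →
                  tangent p m α b A X Y Z * tangent p m α b (- A) X Y Z ≡
                  p * m * ((α * Y - b * X) * (α * Y - b * X))
tangent-product p m α b A X Y Z e f =
  modulo₂ (Z * Z) (p * (α * α) - m * (b * b)) e f (lemma p m α b A X Y Z)
  where
  lemma : ∀ p m α b A X Y Z → (p * α * X - m * b * Y - A * Z) * (p * α * X - m * b * Y - - A * Z) ≡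
          p * m * ((α * Y - b * X) * (α * Y - b * X)) +
          Z * Z * (p * (α * α) - (A * A + m * (b * b))) +
          (p * (α * α) - m * (b * b)) * (p * (X * X) - (Z * Z + m * (Y * Y)))
  lemma = solve-∀

-- Common prime factors of a solution

coprime-or-common-prime : ∀ x y → x ≢ 0ℤ →
  (∀ q → Prime q → + q ∣ x → ¬ + q ∣ y) ⊎ (∃[ q ] Prime q × (+ q ∣ x) × (+ q ∣ y))
coprime-or-common-prime x y x≢0 = go (factorise (gcd ∣ x ∣ ∣ y ∣))
  where
  instance _ = ℕ.≢-nonZero (gcd[m,n]≢0 ∣ x ∣ ∣ y ∣ (inj₁ (x≢0 ∘ ∣i∣≡0⇒i≡0)))
  go : PrimeFactorisation (gcd ∣ x ∣ ∣ y ∣) →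
       (∀ q → Prime q → + q ∣ x → ¬ + q ∣ y) ⊎ (∃[ q ] Prime q × (+ q ∣ x) × (+ q ∣ y))
  go record { factors = [] ; isFactorisation = gcd≡1 } = inj₁ λ q q-prime q∣x q∣y →
    ¬prime[1] (subst Prime (ℕ.∣1⇒≡1 (subst (_ ℕ.∣_) gcd≡1 (gcd-greatest (∣⇒∣ᵤ q∣x) (∣⇒∣ᵤ q∣y)))) q-prime)
  go record { factors = q ∷ qs ; isFactorisation = gcd≡ ; factorsPrime = q-prime ∷ _ } = inj₂
    ( q , q-prime
    , ∣ᵤ⇒∣ (ℕ.∣-trans q∣gcd (gcd[m,n]∣m ∣ x ∣ ∣ y ∣))
    , ∣ᵤ⇒∣ (ℕ.∣-trans q∣gcd (gcd[m,n]∣n ∣ x ∣ ∣ y ∣)) )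
    where
    q∣gcd : q ℕ.∣ gcd ∣ x ∣ ∣ y ∣
    q∣gcd = subst (q ℕ.∣_) (sym gcd≡) (ℕ.m∣m*n (product qs))

square-cancel-prime : ∀ {q} → Prime q → ∀ w n → w * w ≡ n * (+ q * + q) → ∃[ v ] v * v ≡ n
square-cancel-prime {q} q-prime w n eq
  with divides v refl ← ∣-square q-prime w (divides (n * + q) (trans eq (sym (*-assoc n (+ q) (+ q)))))
  = v , *-cancelʳ-≡ _ _ (+ q) (*-cancelʳ-≡ _ _ (+ q)
      (trans (lemma v (+ q)) (trans eq (sym (*-assoc n (+ q) (+ q))))))
  where
  instance _ = prime⇒nonZero q-prime
  lemma : ∀ v q → v * v * q * q ≡ v * q * (v * q)
  lemma = solve-∀

-- As q⁴ divides w², a factor `q` can be cancelled from `w` twice.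
quartic-cancel-prime : ∀ {q} → Prime q → ∀ p m x y w →
  p * (x * + q * (x * + q) * (x * + q * (x * + q))) ≡
  w * w + m * (y * + q * (y * + q) * (y * + q * (y * + q))) →
  ∃[ v ] p * (x * x * (x * x)) ≡ v * v + m * (y * y * (y * y))
quartic-cancel-prime {q} q-prime p m x y w eq =
  proj₁ v , modulo (- + 1) (proj₂ v)
    (lemma′ (p * (x * x * (x * x))) (m * (y * y * (y * y))) (proj₁ v * proj₁ v))
  where
  lemma : ∀ p m x y w q → w * w ≡ (p * (x * x * (x * x)) - m * (y * y * (y * y))) * (q * q) * (q * q) +
          - + 1 * (p * (x * q * (x * q) * (x * q * (x * q))) -
                   (w * w + m * (y * q * (y * q) * (y * q * (y * q)))))
  lemma = solve-∀
  lemma′ : ∀ P M V → P ≡ V + M + - + 1 * (V - (P - M))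
  lemma′ = solve-∀
  n : ℤ
  n = p * (x * x * (x * x)) - m * (y * y * (y * y))
  u : ∃[ u ] u * u ≡ n * (+ q * + q)
  u = square-cancel-prime q-prime w (n * (+ q * + q)) (modulo (- + 1) eq (lemma p m x y w (+ q)))
  v : ∃[ v ] v * v ≡ n
  v = square-cancel-prime q-prime (proj₁ u) n (proj₂ u)

-- Integral solutions of the quartic

module _ {α p m : ℕ} (α-prime : Prime α) (p-prime : Prime p) (m-prime : Prime m)
         (4∣α+1 : + 4 ∣ + α + + 1) (μ : ℤ) (m≡8μ+1 : + m ≡ + 8 * μ + + 1)
         (A b : ℤ) (pα²≡A²+mb² : + p * (+ α * + α) ≡ A * A + + m * (b * b))
         where

  norm-not-3 : ∀ {n} u v → n ≡ u * u + + m * (v * v) → ¬ OddPart -1ℤ n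
  norm-not-3 u v n≡ = norm-OddPart μ u v (trans n≡ (cong (λ t → u * u + t * (v * v)) m≡8μ+1))

  m≢3 : ¬ + 4 ∣ + m + + 1
  m≢3 = OddPart-1⇒≢3 (base {n = + m} (divides (+ 2 * μ) (trans (cong (_- + 1) m≡8μ+1) (lemma μ))))
    where
    lemma : ∀ μ → + 8 * μ + + 1 - + 1 ≡ + 2 * μ * + 4
    lemma = solve-∀

  α-OddPart : OddPart -1ℤ (+ α)
  α-OddPart = base 4∣α+1

  -- Since pα² is a norm and α² has odd part 1 modulo 4, p ≡ 3 (mod 4) would give a norm with odd
  -- part 3.
  p≢3 : ¬ + 4 ∣ + p + + 1
  p≢3 4∣p+1 = norm-not-3 A b pα²≡A²+mb² (OddPart-* {a = + p} (base 4∣p+1) (OddPart-* α-OddPart α-OddPart))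

  ≢3⇒∤ : ∀ {q r} → Prime q → + 4 ∣ + q + + 1 → Prime r → ¬ + 4 ∣ + r + + 1 → ¬ + q ∣ + r
  ≢3⇒∤ q-prime 4∣q+1 r-prime r≢3 q∣r with refl ← prime-∣-prime q-prime r-prime q∣r = r≢3 4∣q+1

  module _ (α∤b : ¬ + α ∣ b) (x y w : ℤ) (coprime : ∀ q → Prime q → + q ∣ x → ¬ + q ∣ y) (x≢0 : x ≢ 0ℤ)
           (px⁴≡w²+my⁴ : + p * (x * x * (x * x)) ≡ w * w + + m * (y * y * (y * y))) where

    X Y L L′ U V W : ℤ
    X = x * x
    Y = y * y
    L = tangent (+ p) (+ m) (+ α) b A X Y w
    L′ = tangent (+ p) (+ m) (+ α) b (- A) X Y w
    U = + α * w - A * X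
    V = + α * Y - b * X
    W = b * w - A * Y

    2αXL≡ : + 2 * + α * X * L ≡ U * U + + m * (V * V)
    2αXL≡ = tangent-norm₁ (+ p) (+ m) (+ α) b A X Y w pα²≡A²+mb² px⁴≡w²+my⁴

    2bYL≡ : + 2 * b * Y * L ≡ W * W + - + p * (V * V)
    2bYL≡ = tangent-norm₂ (+ p) (+ m) (+ α) b A X Y w pα²≡A²+mb² px⁴≡w²+my⁴

    LL′≡ : L * L′ ≡ + p * + m * (V * V)
    LL′≡ = tangent-product (+ p) (+ m) (+ α) b A X Y w pα²≡A²+mb² px⁴≡w²+my⁴

    -- If αY = bX, then `α`, not dividing `b`, divides `x`. So α² divides bX and `α` divides `Y`,
    -- against coprimality.
    V≢0 : V ≢ 0ℤ
    V≢0 V≡0 = contradiction α∣x α∤x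
      where
      instance _ = prime⇒nonZero α-prime
      αY≡bX : + α * Y ≡ b * X
      αY≡bX = i-j≡0⇒i≡j (+ α * Y) (b * X) V≡0
      α∣x : + α ∣ x
      α∣x = [ (λ α∣b → contradiction α∣b α∤b) , ∣-square α-prime x ]′
        (euclid α-prime b X (subst (+ α ∣_) αY≡bX (∣m⇒∣m*n Y ∣-refl)))
      α∤x : ¬ + α ∣ x
      α∤x α∣x@(divides k x≡kα) = coprime α α-prime α∣x (∣-square α-prime y
        (divides (b * (k * k)) (*-cancelˡ-≡ (+ α) _ _
          (trans αY≡bX (trans (cong (λ t → b * (t * t)) x≡kα) (lemma b k (+ α)))))))
        where
        lemma : ∀ b k α → b * (k * α * (k * α)) ≡ α * (b * (k * k) * α)
        lemma = solve-∀

    2αX-positive : ∃[ c ] + 2 * + α * X ≡ + suc c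
    2αX-positive = ℕ.pred n , trans 2αX≡n (cong +_ (sym (ℕ.suc-pred n)))
      where
      n : ℕ
      n = 2 ℕ.* α ℕ.* (∣ x ∣ ℕ.* ∣ x ∣)
      2αX≡n : + 2 * + α * X ≡ + n
      2αX≡n = trans (cong₂ _*_ (sym (pos-* 2 α)) (square≡+ x)) (sym (pos-* (2 ℕ.* α) (∣ x ∣ ℕ.* ∣ x ∣)))
      instance
        _ = prime⇒nonZero α-prime
        _ = ≢-nonZero x≢0
        _ = ℕ.m*n≢0 2 α
        _ = ℕ.m*n≢0 ∣ x ∣ ∣ x ∣
        _ = ℕ.m*n≢0 (2 ℕ.* α) (∣ x ∣ ℕ.* ∣ x ∣)

    L≢0 : L ≢ 0ℤ
    L≢0 L≡0 = V≢0 (proj₂ (norm≡0⇒≡0 m {{prime⇒nonZero m-prime}} U V (trans (sym 2αXL≡)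
      (trans (cong (+ 2 * + α * X *_) L≡0) (*-zeroʳ (+ 2 * + α * X))))))

    -- The factor 2αX is positive and 2αXL is a norm. The sign matters: factorisation sees only ∣ L
    -- ∣, and a change of sign interchanges the odd parts 1 and 3 modulo 4.
    0≤L : 0ℤ ≤ L
    0≤L with c , 2αX≡ ← 2αX-positive = *-cancelˡ-≤-pos 0ℤ L (+ suc c)
      (≤-trans (≤-reflexive (*-zeroʳ (+ suc c))) (subst (0ℤ ≤_)
        (trans (sym (norm≡+ m U V)) (trans (sym 2αXL≡) (cong (_* L) 2αX≡)))
        (+≤+ z≤n)))

    -- The odd part of 2αX is 3 modulo 4. Were that of `L` equal to 1, the norm 2αXL would have odd
    -- part 3.
    L-prime : ∃[ q ] Prime q × (+ 4 ∣ + q + + 1) × OddValuation q L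
    L-prime = [ (λ h → ⊥-elim (norm-not-3 U V 2αXL≡ (OddPart-* 2αX-OddPart h))) , id ]′
      (odd-valuation-prime⁺ 0≤L L≢0)
      where
      2αX-OddPart : OddPart -1ℤ (+ 2 * + α * X)
      2αX-OddPart = OddPart-* (double α-OddPart) (OddPart-square x≢0)

    -- Contradiction at a prime q ≡ 3 (mod 4) of odd valuation in `L`

    module _ {q : ℕ} (q-prime : Prime q) (4∣q+1 : + 4 ∣ + q + + 1) (h : OddValuation q L) where

      q∤p : ¬ + q ∣ + p
      q∤p = ≢3⇒∤ q-prime 4∣q+1 p-prime p≢3

      q∤m : ¬ + q ∣ + m
      q∤m = ≢3⇒∤ q-prime 4∣q+1 m-prime m≢3

      q∤2 : ¬ + q ∣ + 2
      q∤2 = ≢3⇒∤ q-prime 4∣q+1 prime[2] (from-no (+ 4 ∣? + 3))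

      q∣L′ : + q ∣ L′
      q∣L′ = OddValuation-cofactor q-prime (∤-* q-prime q∤p q∤m) L′ V h LL′≡

      q∣V : + q ∣ V
      q∣V = ∣-square q-prime V ([ (λ q∣pm → contradiction q∣pm (∤-* q-prime q∤p q∤m)) , id ]′
        (euclid q-prime (+ p * + m) (V * V) (subst (+ q ∣_) LL′≡ (∣m⇒∣m*n L′ (OddValuation-∣ h)))))

      -- `L` and `L′` are `F - A * w` and `F + A * w`, so 2F is their sum.
      F : ℤ
      F = + p * + α * X - + m * b * Y

      q∣F : + q ∣ F
      q∣F = [ (λ q∣2 → contradiction q∣2 q∤2) , id ]′ (euclid q-prime (+ 2) F
        (∣-combine (+ 1) (+ 1) (OddValuation-∣ h) q∣L′ (lemma F A w)))
        where
        lemma : ∀ F A w → + 2 * F ≡ + 1 * (F - A * w) + + 1 * (F - - A * w)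
        lemma = solve-∀

      -- Modulo `q` the linear forms `F` and `V` in `X`, `Y` vanish. Their determinant is pα² - mb²
      -- = A², so by Cramer's rule `q` divides A²X and A²Y, while `x` and `y` are coprime.
      q∣A : + q ∣ A
      q∣A = decidable-stable (+ q ∣? A) λ q∤A → coprime q q-prime (root q∤A x q∣A²X) (root q∤A y q∣A²Y)
        where
        root : ¬ + q ∣ A → ∀ i → + q ∣ A * A * (i * i) → + q ∣ i
        root q∤A i = [ (λ q∣A² → contradiction q∣A² (∤-* q-prime q∤A q∤A)) , ∣-square q-prime i ]′ ∘
                 euclid q-prime (A * A) (i * i)
        q∣A²X : + q ∣ A * A * X
        q∣A²X = ∣-combine (+ α) (+ m * b) q∣F q∣V
          (modulo (- X) pα²≡A²+mb² (lemma (+ p) (+ m) (+ α) b A X Y))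
          where
          lemma : ∀ p m α b A X Y → A * A * X ≡
                  α * (p * α * X - m * b * Y) + m * b * (α * Y - b * X) +
                  - X * (p * (α * α) - (A * A + m * (b * b)))
          lemma = solve-∀
        q∣A²Y : + q ∣ A * A * Y
        q∣A²Y = ∣-combine b (+ p * + α) q∣F q∣V
          (modulo (- Y) pα²≡A²+mb² (lemma (+ p) (+ m) (+ α) b A X Y))
          where
          lemma : ∀ p m α b A X Y → A * A * Y ≡
                  b * (p * α * X - m * b * Y) + p * α * (α * Y - b * X) +
                  - Y * (p * (α * α) - (A * A + m * (b * b)))
          lemma = solve-∀

      -- Otherwise `q` divides pα², hence equals `α`, which does not divide `b`.
      q∤b : ¬ + q ∣ b
      q∤b q∣b = [ q∤p , (λ q∣α² → α∤b (subst (λ r → + r ∣ b)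
          (prime-∣-prime q-prime α-prime (∣-square q-prime (+ α) q∣α²)) q∣b)) ]′
        (euclid q-prime (+ p) (+ α * + α)
          (∣-combine A (+ m * b) q∣A q∣b (trans pα²≡A²+mb² (lemma (+ m) b A))))
        where
        lemma : ∀ m b A → A * A + m * (b * b) ≡ A * A + m * b * b
        lemma = solve-∀

      q∤α : ¬ + q ∣ + α
      q∤α q∣α = ∤-* q-prime q∤m (∤-* q-prime q∤b q∤b)
        (∣-combine (+ p * + α) (- A) q∣α q∣A (modulo (- + 1) pα²≡A²+mb² (lemma (+ p) (+ m) (+ α) b A)))
        where
        lemma : ∀ p m α b A → m * (b * b) ≡
                p * α * α + - A * A + - + 1 * (p * (α * α) - (A * A + m * (b * b)))
        lemma = solve-∀

      -- Modulo `q`, αY ≡ bX with `α` and `b` invertible, so a factor `q` of one of `x`, `y` would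
      -- be shared by the other.
      q∤x : ¬ + q ∣ x
      q∤x q∣x = coprime q q-prime q∣x (∣-square q-prime y ([ (λ q∣α → contradiction q∣α q∤α) , id ]′
        (euclid q-prime (+ α) Y (∣-combine (+ 1) (b * x) q∣V q∣x (lemma (+ α) b x Y)))))
        where
        lemma : ∀ α b x Y → α * Y ≡ + 1 * (α * Y - b * (x * x)) + b * x * x
        lemma = solve-∀

      q∤y : ¬ + q ∣ y
      q∤y q∣y = q∤x (∣-square q-prime x ([ (λ q∣b → contradiction q∣b q∤b) , id ]′
        (euclid q-prime b X (∣-combine (- + 1) (+ α * y) q∣V q∣y (lemma (+ α) b X y)))))
        where
        lemma : ∀ α b X y → b * X ≡ - + 1 * (α * (y * y) - b * X) + α * y * y
        lemma = solve-∀

      -- The factors 2bY and 2αX are prime to `q`, so both norms have odd valuation at `q`. Hence p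
      -- and -m are the squares of u₁ / v₁ and u₂ / v₂ modulo `q`.
      L-prime-absurd : ⊥
      L-prime-absurd =
        let u₁ , v₁ , q∤v₁ , q∣norm₁ = norm-residue q-prime (- + p) W V
              (OddValuation-* q-prime (∤-* q-prime (∤-* q-prime q∤2 q∤b) (∤-* q-prime q∤y q∤y)) h) 2bYL≡
            u₂ , v₂ , q∤v₂ , q∣norm₂ = norm-residue q-prime (+ m) U V
              (OddValuation-* q-prime (∤-* q-prime (∤-* q-prime q∤2 q∤α) (∤-* q-prime q∤x q∤x)) h) 2αXL≡
        in absurd u₁ v₁ u₂ v₂ q∤v₁ q∣norm₁ q∤v₂ q∣norm₂
        where
        absurd : ∀ u₁ v₁ u₂ v₂ → ¬ + q ∣ v₁ → + q ∣ u₁ * u₁ + - + p * (v₁ * v₁) →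
                 ¬ + q ∣ v₂ → + q ∣ u₂ * u₂ + + m * (v₂ * v₂) → ⊥
        absurd u₁ v₁ u₂ v₂ q∤v₁ q∣norm₁ q∤v₂ q∣norm₂ =
          ∤-* q-prime (∤-* q-prime (q∤u₁ u₁ v₁ q∤v₁ q∣norm₁) q∤α) q∤v₂
            -- Modulo `q` the sum of these two squares is (v₁v₂)²(pα² - mb²) = (v₁v₂A)², and `q`
            -- divides `A`.
            (prime-∣-sum-of-squares q-prime 4∣q+1 (u₂ * b * v₁) (u₁ * + α * v₂)
              (∣-combine (+ 1) (v₁ * v₁ * (v₂ * v₂) * A)
                (∣-combine (+ α * v₂ * (+ α * v₂)) (b * v₁ * (b * v₁)) q∣norm₁ q∣norm₂ refl) q∣A
                (modulo (v₁ * v₁ * (v₂ * v₂)) pα²≡A²+mb² (lemma (+ p) (+ m) (+ α) b A u₁ v₁ u₂ v₂))))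
          where
          lemma : ∀ p m α b A u₁ v₁ u₂ v₂ →
            u₂ * b * v₁ * (u₂ * b * v₁) + u₁ * α * v₂ * (u₁ * α * v₂) ≡
            + 1 * (α * v₂ * (α * v₂) * (u₁ * u₁ + - p * (v₁ * v₁)) +
                   b * v₁ * (b * v₁) * (u₂ * u₂ + m * (v₂ * v₂))) +
            v₁ * v₁ * (v₂ * v₂) * A * A +
            v₁ * v₁ * (v₂ * v₂) * (p * (α * α) - (A * A + m * (b * b)))
          lemma = solve-∀
          q∤u₁ : ∀ u₁ v₁ → ¬ + q ∣ v₁ → + q ∣ u₁ * u₁ + - + p * (v₁ * v₁) → ¬ + q ∣ u₁
          q∤u₁ u₁ v₁ q∤v₁ q∣norm₁ q∣u₁ = ∤-* q-prime q∤p (∤-* q-prime q∤v₁ q∤v₁)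
            (∣-combine (- + 1) u₁ q∣norm₁ q∣u₁ (lemma′ (+ p) u₁ v₁))
            where
            lemma′ : ∀ p u v → p * (v * v) ≡ - + 1 * (u * u + - p * (v * v)) + u * u
            lemma′ = solve-∀

    no-coprime-solution : ⊥
    no-coprime-solution = let _ , q-prime , 4∣q+1 , h = L-prime in L-prime-absurd q-prime 4∣q+1 h

  -- Infinite descent on ∣ x ∣: common primes of `x` and `y` are divided out until the coprime case
  -- applies.
  no-solution : ¬ + α ∣ b → ∀ x y w → + p * (x * x * (x * x)) ≡ w * w + + m * (y * y * (y * y)) → x ≡ 0ℤ
  no-solution α∤b x y w eq = decidable-stable (x ≟ 0ℤ) λ x≢0 → <-rec P step ∣ x ∣ x y w refl x≢0 eq
    where
    P : ℕ → Set
    P n = ∀ x y w → ∣ x ∣ ≡ n → x ≢ 0ℤ → + p * (x * x * (x * x)) ≢ w * w + + m * (y * y * (y * y))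
    step : ∀ n → (∀ {k} → k ℕ.< n → P k) → P n
    step _ rec x y w refl x≢0 eq =
      [ (λ coprime → no-coprime-solution α∤b x y w coprime x≢0 eq)
      , (λ (q , q-prime , q∣x , q∣y) → descend q-prime q∣x q∣y x≢0 eq rec) ]′
      (coprime-or-common-prime x y x≢0)
      where
      descend : ∀ {q x y} → Prime q → + q ∣ x → + q ∣ y → x ≢ 0ℤ →
                + p * (x * x * (x * x)) ≡ w * w + + m * (y * y * (y * y)) →
                (∀ {k} → k ℕ.< ∣ x ∣ → P k) → ⊥
      descend {q} q-prime (divides x′ refl) (divides y′ refl) x≢0 eq rec =
        let v , eq′ = quartic-cancel-prime q-prime (+ p) (+ m) x′ y′ w eq
        in rec ∣x′∣<∣x∣ x′ y′ v refl x′≢0 eq′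
        where
        x′≢0 : x′ ≢ 0ℤ
        x′≢0 x′≡0 = x≢0 (cong (_* + q) x′≡0)
        instance _ = ≢-nonZero x′≢0
        ∣x′∣<∣x∣ : ∣ x′ ∣ ℕ.< ∣ x′ * + q ∣
        ∣x′∣<∣x∣ = subst (∣ x′ ∣ ℕ.<_) (sym (abs-* x′ (+ q)))
          (ℕ.m<m*n ∣ x′ ∣ q (ℕ.nonTrivial⇒n>1 q {{prime⇒nonTrivial q-prime}}))

-- Passage between integral and rational coordinates

-- `i / 1` is stuck for a variable `i`, whereas the operations of ℚ reduce on `mkℚ`.
fromℤ≡mkℚ : ∀ i → fromℤ i ≡ mkℚ i 0 (Coprimality.sym (1-coprimeTo ∣ i ∣))
fromℤ≡mkℚ i = ℚ.fromℚᵘ-toℚᵘ (mkℚ i 0 (Coprimality.sym (1-coprimeTo ∣ i ∣)))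

fromℤ-injective : ∀ {i j} → fromℤ i ≡ fromℤ j → i ≡ j
fromℤ-injective {i} {j} eq = cong ↥_ (trans (sym (fromℤ≡mkℚ i)) (trans eq (fromℤ≡mkℚ j)))

fromℤ-* : ∀ i j → fromℤ (i * j) ≡ fromℤ i ℚ.* fromℤ j
fromℤ-* i j = sym (cong₂ ℚ._*_ (fromℤ≡mkℚ i) (fromℤ≡mkℚ j))

fromℤ-+ : ∀ i j → fromℤ (i + j) ≡ fromℤ i ℚ.+ fromℤ j
fromℤ-+ i j = trans (cong₂ (λ s t → fromℤ (s + t)) (sym (*-identityʳ i)) (sym (*-identityʳ j)))
  (sym (cong₂ ℚ._+_ (fromℤ≡mkℚ i) (fromℤ≡mkℚ j)))

fromℤ-neg : ∀ i → fromℤ (- i) ≡ ℚ.- fromℤ i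
fromℤ-neg i = trans (fromℤ≡mkℚ (- i)) (trans (lemma i) (cong ℚ.-_ (sym (fromℤ≡mkℚ i))))
  where
  lemma : ∀ i → mkℚ (- i) 0 (Coprimality.sym (1-coprimeTo ∣ - i ∣)) ≡
                ℚ.- mkℚ i 0 (Coprimality.sym (1-coprimeTo ∣ i ∣))
  lemma (+ zero)  = refl
  lemma (+ suc _) = refl
  lemma -[1+ _ ]  = refl

fromℤ-- : ∀ i j → fromℤ (i - j) ≡ fromℤ i ℚ.- fromℤ j
fromℤ-- i j = trans (fromℤ-+ i (- j)) (cong (fromℤ i ℚ.+_) (fromℤ-neg j))

fromℤ-^2 : ∀ i → fromℤ i ^ 2 ≡ fromℤ (i * i)
fromℤ-^2 i = trans (cong (fromℤ i ℚ.*_) (ℚ.*-identityʳ (fromℤ i))) (sym (fromℤ-* i i))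

fromℤ-^4 : ∀ i → fromℤ i ^ 4 ≡ fromℤ (i * i * (i * i))
fromℤ-^4 i = trans (lemma (fromℤ i))
  (trans (cong₂ ℚ._*_ (fromℤ-^2 i) (fromℤ-^2 i)) (sym (fromℤ-* (i * i) (i * i))))
  where
  open +-*-Solver
  lemma : ∀ x → x ^ 4 ≡ (x ^ 2) ℚ.* (x ^ 2)
  lemma = solve 1 (λ x →
    x :* (x :* (x :* (x :* con ℚ.1ℚ))) := (x :* (x :* con ℚ.1ℚ)) :* (x :* (x :* con ℚ.1ℚ))) refl

fromℤ-form : ∀ p m x y → fromℤ p ℚ.* fromℤ x ℚ.- fromℤ m ℚ.* fromℤ y ≡ fromℤ (p * x - m * y)
fromℤ-form p m x y = sym (trans (fromℤ-- (p * x) (m * y)) (cong₂ ℚ._-_ (fromℤ-* p x) (fromℤ-* m y)))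

fromℤ³ : ℤ × ℤ × ℤ → ℚ³
fromℤ³ (x , y , z) = fromℤ x , fromℤ y , fromℤ z

conic-fromℤ : ∀ p m x y z → p * (x * x) ≡ z * z + m * (y * y) → ConicEquation p m (fromℤ³ (x , y , z))
conic-fromℤ p m x y z eq = trans
  (cong₂ (λ s t → fromℤ p ℚ.* s ℚ.- fromℤ m ℚ.* t) (fromℤ-^2 x) (fromℤ-^2 y))
  (trans (fromℤ-form p m (x * x) (y * y)) (trans (cong fromℤ eq′) (sym (fromℤ-^2 z))))
  where
  lemma : ∀ P M Z → P - M ≡ Z + + 1 * (P - (Z + M))
  lemma = solve-∀
  eq′ : p * (x * x) - m * (y * y) ≡ z * z
  eq′ = modulo (+ 1) eq (lemma (p * (x * x)) (m * (y * y)) (z * z))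

quartic-fromℤ : ∀ p m x y z → QuarticEquation p m (fromℤ³ (x , y , z)) →
                p * (x * x * (x * x)) ≡ z * z + m * (y * y * (y * y))
quartic-fromℤ p m x y z eq =
  modulo (+ 1) eqℤ (lemma (p * (x * x * (x * x))) (m * (y * y * (y * y))) (z * z))
  where
  eqℤ : p * (x * x * (x * x)) - m * (y * y * (y * y)) ≡ z * z
  eqℤ = fromℤ-injective (trans (sym (fromℤ-form p m (x * x * (x * x)) (y * y * (y * y))))
    (trans (sym (cong₂ (λ s t → fromℤ p ℚ.* s ℚ.- fromℤ m ℚ.* t) (fromℤ-^4 x) (fromℤ-^4 y)))
      (trans eq (fromℤ-^2 z))))
  lemma : ∀ P M Z → P ≡ Z + M + + 1 * (P - M - Z)
  lemma = solve-∀

-- Cross products eliminate the scalar `t` and leave equations between integers.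
proportional-cross : ∀ x y z x′ y′ z′ → Proportional (fromℤ³ (x , y , z)) (fromℤ³ (x′ , y′ , z′)) →
                     x * y′ ≡ x′ * y × z * y′ ≡ z′ * y
proportional-cross x y z x′ y′ z′ (t , _ , eq) = cross x x′ x≡ , cross z z′ z≡
  where
  x≡ : fromℤ x ≡ t ℚ.* fromℤ x′
  x≡ = cong proj₁ eq
  y≡ : fromℤ y ≡ t ℚ.* fromℤ y′
  y≡ = cong (proj₁ ∘ proj₂) eq
  z≡ : fromℤ z ≡ t ℚ.* fromℤ z′
  z≡ = cong (proj₂ ∘ proj₂) eq
  open +-*-Solver
  lemma : ∀ t u v → (t ℚ.* u) ℚ.* v ≡ u ℚ.* (t ℚ.* v)
  lemma = solve 3 (λ t u v → (t :* u) :* v := u :* (t :* v)) refl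
  cross : ∀ u u′ → fromℤ u ≡ t ℚ.* fromℤ u′ → u * y′ ≡ u′ * y
  cross u u′ u≡ = fromℤ-injective (trans (fromℤ-* u y′)
    (trans (cong (ℚ._* fromℤ y′) u≡) (trans (lemma t (fromℤ u′) (fromℤ y′))
      (trans (cong (fromℤ u′ ℚ.*_) (sym y≡)) (sym (fromℤ-* u′ y))))))

↧*≡↥ : ∀ x → fromℤ (↧ x) ℚ.* x ≡ fromℤ (↥ x)
↧*≡↥ x@(mkℚ n d-1 _) = trans (cong (ℚ._* x) (fromℤ≡mkℚ (↧ x)))
  (trans (ℚ.toℚᵘ-injective (ℚᵘ.≃-trans
      (ℚ.toℚᵘ-homo-* (mkℚ (↧ x) 0 (Coprimality.sym (1-coprimeTo (suc d-1)))) x) (ℚᵘ.*≡* dn≡nd)))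
    (sym (fromℤ≡mkℚ n)))
  where
  dn≡nd : + suc d-1 * n * + 1 ≡ n * + suc (d-1 ℕ.+ 0)
  dn≡nd = trans (*-identityʳ (+ suc d-1 * n))
    (trans (*-comm (+ suc d-1) n) (cong (λ k → n * + suc k) (sym (ℕ.+-identityʳ d-1))))

-- The equation is homogeneous with weights 1, 1, 2, so the third coordinate takes d².
quartic-scale : ∀ p m d x y z → QuarticEquation p m (x , y , z) →
                QuarticEquation p m (d ℚ.* x , d ℚ.* y , d ℚ.* (d ℚ.* z))
quartic-scale p m d x y z eq = trans (lemma (fromℤ p) (fromℤ m) d x y)
  (trans (cong ((d ^ 4) ℚ.*_) eq) (lemma′ d z))
  where
  open +-*-Solver
  lemma : ∀ p m d x y → p ℚ.* ((d ℚ.* x) ^ 4) ℚ.- m ℚ.* ((d ℚ.* y) ^ 4) ≡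
          (d ^ 4) ℚ.* (p ℚ.* (x ^ 4) ℚ.- m ℚ.* (y ^ 4))
  lemma = solve 5 (λ p m d x y →
    let _^⁴ = λ x → x :* (x :* (x :* (x :* con ℚ.1ℚ))) in
    p :* ((d :* x) ^⁴) :- m :* ((d :* y) ^⁴) := (d ^⁴) :* (p :* (x ^⁴) :- m :* (y ^⁴))) refl
  lemma′ : ∀ d z → (d ^ 4) ℚ.* (z ^ 2) ≡ (d ℚ.* (d ℚ.* z)) ^ 2
  lemma′ = solve 2 (λ d z →
    let _^⁴ = λ x → x :* (x :* (x :* (x :* con ℚ.1ℚ)))
        _^² = λ x → x :* (x :* con ℚ.1ℚ) in
    (d ^⁴) :* (z ^²) := (d :* (d :* z)) ^²) refl

clear-denominator : ∀ k x → fromℤ (k * ↧ x) ℚ.* x ≡ fromℤ (k * ↥ x)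
clear-denominator k x = trans (cong (ℚ._* x) (fromℤ-* k (↧ x)))
  (trans (ℚ.*-assoc (fromℤ k) (fromℤ (↧ x)) x)
    (trans (cong (fromℤ k ℚ.*_) (↧*≡↥ x)) (sym (fromℤ-* k (↥ x)))))

quartic-clear : ∀ p m x y z → QuarticEquation p m (x , y , z) →
  QuarticEquation p m (fromℤ³ (↧ y * ↧ z * ↥ x , ↧ x * ↧ z * ↥ y , ↧ x * ↧ y * ↧ z * (↧ x * ↧ y * ↥ z)))
quartic-clear p m x y z eq = subst (QuarticEquation p m)
  (cong₂ _,_ Dx (cong₂ _,_ Dy
    (trans (cong (fromℤ D ℚ.*_) (clear-denominator (↧ x * ↧ y) z)) (sym (fromℤ-* D (↧ x * ↧ y * ↥ z))))))
  (quartic-scale p m (fromℤ D) x y z eq)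
  where
  D : ℤ
  D = ↧ x * ↧ y * ↧ z
  rotate : ∀ a b c → a * b * c ≡ b * c * a
  rotate = solve-∀
  swap : ∀ a b c → a * b * c ≡ a * c * b
  swap = solve-∀
  Dx : fromℤ D ℚ.* x ≡ fromℤ (↧ y * ↧ z * ↥ x)
  Dx = trans (cong (λ d → fromℤ d ℚ.* x) (rotate (↧ x) (↧ y) (↧ z))) (clear-denominator (↧ y * ↧ z) x)
  Dy : fromℤ D ℚ.* y ≡ fromℤ (↧ x * ↧ z * ↥ y)
  Dy = trans (cong (λ d → fromℤ d ℚ.* y) (swap (↧ x) (↧ y) (↧ z))) (clear-denominator (↧ x * ↧ z) y)

numerator-zero : ∀ k .{{_ : NonZero k}} x → k * ↥ x ≡ 0ℤ → x ≡ 0ℚ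
numerator-zero k x eq = ℚ.↥p≡0⇒p≡0 x (*-cancelˡ-≡ k (↥ x) 0ℤ (trans eq (sym (*-zeroʳ k))))

-- Once x = 0, the equation z² + my⁴ = 0 with m > 0 forces y = z = 0.
quartic-trivial : ∀ p m .{{_ : ℕ.NonZero m}} →
  (∀ x y w → p * (x * x * (x * x)) ≡ w * w + + m * (y * y * (y * y)) → x ≡ 0ℤ) →
  ∀ P → QuarticEquation p (+ m) P → P ≡ 0ℚ³
quartic-trivial p m x≡0 (x , y , z) eq =
  cong₂ _,_ (numerator-zero (↧ y * ↧ z) x x′≡0)
    (cong₂ _,_ (numerator-zero (↧ x * ↧ z) y y′≡0) (numerator-zero (↧ x * ↧ y) z z′≡0))
  where
  x′ y′ z′ d : ℤ
  x′ = ↧ y * ↧ z * ↥ x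
  y′ = ↧ x * ↧ z * ↥ y
  z′ = ↧ x * ↧ y * ↥ z
  d = ↧ x * ↧ y * ↧ z
  eqℤ : p * (x′ * x′ * (x′ * x′)) ≡ d * z′ * (d * z′) + + m * (y′ * y′ * (y′ * y′))
  eqℤ = quartic-fromℤ p (+ m) x′ y′ (d * z′) (quartic-clear p (+ m) x y z eq)
  x′≡0 : x′ ≡ 0ℤ
  x′≡0 = x≡0 x′ y′ (d * z′) eqℤ
  norm≡0 : d * z′ * (d * z′) + + m * (y′ * y′ * (y′ * y′)) ≡ 0ℤ
  norm≡0 = trans (sym eqℤ) (trans (cong (λ t → p * (t * t * (t * t))) x′≡0) (*-zeroʳ p))
  y′≡0 : y′ ≡ 0ℤ
  y′≡0 = square≡0⇒≡0 y′ (proj₂ (norm≡0⇒≡0 m (d * z′) (y′ * y′) norm≡0))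
  z′≡0 : z′ ≡ 0ℤ
  z′≡0 = *-cancelˡ-≡ d z′ 0ℤ (trans (proj₁ (norm≡0⇒≡0 m (d * z′) (y′ * y′) norm≡0)) (sym (*-zeroʳ d)))

-- Rational points of the conic

prime-nonsquare : ∀ {q} → Prime q → ∀ s → s * s ≢ + q
prime-nonsquare {q} q-prime s s²≡q with divides k s≡kq ← ∣-square q-prime s (∣-reflexive (sym s²≡q)) =
  ¬prime[1] (subst Prime (ℕ.∣1⇒≡1 (∣⇒∣ᵤ (divides (k * k) (*-cancelʳ-≡ (+ 1) (k * k * + q) (+ q)
    (trans (*-identityˡ (+ q)) (trans (sym s²≡q) (trans (cong₂ _*_ s≡kq s≡kq) (lemma k (+ q))))))))) q-prime)
  where
  instance _ = prime⇒nonZero q-prime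
  lemma : ∀ k q → k * q * (k * q) ≡ k * k * q * q
  lemma = solve-∀

square-injective : ∀ {i j} → i ℕ.* i ≡ j ℕ.* j → i ≡ j
square-injective {i} {j} eq with ℕ.<-cmp i j
... | tri≈ _ i≡j _ = i≡j
... | tri< i<j _ _ = contradiction eq (ℕ.<⇒≢ (ℕ.*-mono-< i<j i<j))
... | tri> _ _ j<i = contradiction (sym eq) (ℕ.<⇒≢ (ℕ.*-mono-< j<i j<i))

-- Multiplying A + α√p by (n + √p)² changes its norm A² - p α² = - m b² by the
-- square of n² - p, so that b is to be scaled by n² - p.
conicPoint : (p α b A n : ℤ) → ℤ × ℤ × ℤ
conicPoint p α b A n = α * (n * n + p) + + 2 * n * A , b * (n * n - p) , A * (n * n + p) + + 2 * n * p * α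

conicPoint-on-conic : ∀ p m α b A n → p * (α * α) ≡ A * A + m * (b * b) →
                      ConicEquation p m (fromℤ³ (conicPoint p α b A n))
conicPoint-on-conic p m α b A n eq = let x , y , z = conicPoint p α b A n in conic-fromℤ p m x y z
  (modulo ((n * n - p) * (n * n - p)) eq (lemma p m α b A n))
  where
  lemma : ∀ p m α b A n →
    p * ((α * (n * n + p) + + 2 * n * A) * (α * (n * n + p) + + 2 * n * A)) ≡
    (A * (n * n + p) + + 2 * n * p * α) * (A * (n * n + p) + + 2 * n * p * α) +
    m * (b * (n * n - p) * (b * (n * n - p))) +
    (n * n - p) * (n * n - p) * (p * (α * α) - (A * A + m * (b * b)))
  lemma = solve-∀

-- A Z - p α X = - m b² (n² + p) at the point with parameter n, so that the point
-- determines the ratio of n² + p to n² - p.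
conicPoint-proportional : ∀ p m α b A i j → p * (α * α) ≡ A * A + m * (b * b) →
  Proportional (fromℤ³ (conicPoint p α b A i)) (fromℤ³ (conicPoint p α b A j)) →
  + 2 * p * m * b * b * b * (i * i) ≡ + 2 * p * m * b * b * b * (j * j)
conicPoint-proportional p m α b A i j eq prop =
  let x , y , z = conicPoint p α b A i
      x′ , y′ , z′ = conicPoint p α b A j
      xy′≡x′y , zy′≡z′y = proportional-cross x y z x′ y′ z′ prop
  in modulo (- (p * α)) xy′≡x′y (modulo A zy′≡z′y
       (modulo (- (+ 2 * p * b * (i * i - j * j))) eq (lemma p m α b A i j)))
  where
  lemma : ∀ p m α b A i j →
    + 2 * p * m * b * b * b * (i * i) ≡ + 2 * p * m * b * b * b * (j * j) +
    - (p * α) * ((α * (i * i + p) + + 2 * i * A) * (b * (j * j - p)) -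
                 (α * (j * j + p) + + 2 * j * A) * (b * (i * i - p))) +
    A * ((A * (i * i + p) + + 2 * i * p * α) * (b * (j * j - p)) -
         (A * (j * j + p) + + 2 * j * p * α) * (b * (i * i - p))) +
    - (+ 2 * p * b * (i * i - j * j)) * (p * (α * α) - (A * A + m * (b * b)))
  lemma = solve-∀

-- The factor 2pmb³ is nonzero, so proportional points have parameters with equal squares, and a
-- natural number is determined by its square.
infinitely-many : ∀ {p} → Prime p → ∀ m α b A → + p * (α * α) ≡ A * A + m * (b * b) →
                  m ≢ 0ℤ → b ≢ 0ℤ → InfinitelyManyRationalPoints (+ p) m
infinitely-many {p} p-prime m α b A eq m≢0 b≢0 =
    (λ n → fromℤ³ (point n))
  , (λ n → point≢0 n , conicPoint-on-conic (+ p) m α b A (+ n) eq)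
  , (λ i j i≢j prop → i≢j (square-injective (+-injective (trans (pos-* i i) (trans
      (*-cancelˡ-≡ (+ 2 * + p * m * b * b * b) (+ i * + i) (+ j * + j)
        (conicPoint-proportional (+ p) m α b A (+ i) (+ j) eq prop))
      (sym (pos-* j j)))))))
  where
  point : ℕ → ℤ × ℤ × ℤ
  point n = conicPoint (+ p) α b A (+ n)
  instance
    _ = prime⇒nonZero p-prime
    _ = ≢-nonZero m≢0
    _ = ≢-nonZero b≢0
    _ = i*j≢0 (+ 2) (+ p)
    _ = i*j≢0 (+ 2 * + p) m
    _ = i*j≢0 (+ 2 * + p * m) b
    _ = i*j≢0 (+ 2 * + p * m * b) b
    _ = i*j≢0 (+ 2 * + p * m * b * b) b
  point≢0 : ∀ n → fromℤ³ (point n) ≢ 0ℚ³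
  -- The second coordinate is b(n² - p), and the prime `p` is not a square.
  point≢0 n eq = [ b≢0 , (λ n²-p≡0 → prime-nonsquare p-prime (+ n) (i-j≡0⇒i≡j (+ n * + n) (+ p) n²-p≡0)) ]′
    (i*j≡0⇒i≡0∨j≡0 b (fromℤ-injective {j = 0ℤ} (cong (proj₁ ∘ proj₂) eq)))

theorem3 : (α β γ a b p m : ℤ) →
    p ≡ (α ^ℤ 2) * (a ^ℤ 2) + (+ 2) * β * a * b + γ * (b ^ℤ 2) →
    IsPrime p →
    m ≡ (α ^ℤ 2) * γ - (β ^ℤ 2) →
    ( IsRationalPoint p m (fromℤ α , fromℤ b , fromℤ ((α ^ℤ 2) * a + β * b))
    × (m ≢ 0ℤ → InfinitelyManyRationalPoints p m) )
    × ( IsPrime m → m ≡ (+ 1) [mod (+ 8) ] →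
    IsPrime α → α ≡ (+ 3) [mod (+ 4) ] →
    (P : ℚ³) → QuarticEquation p m P → P ≡ 0ℚ³ )
theorem3 α β γ a b p m p≡ (pₙ , p-prime , refl) m≡ =
  ( ((λ P≡0 → b≢0 (fromℤ-injective {j = 0ℤ} (cong (proj₁ ∘ proj₂) P≡0))) , conic-fromℤ p m α b A pα²≡)
  , (λ m≢0 → infinitely-many p-prime m α b A pα²≡ m≢0 b≢0) )
  , no-points
  where
  A : ℤ
  A = (α ^ℤ 2) * a + β * b
  pα²≡ : p * (α * α) ≡ A * A + m * (b * b)
  pα²≡ = modulo₂ (α * α) (- (b * b)) p≡ m≡ (lemma α β γ a b p m)
    where
    -- Completing the square in α²p. Powers are spelled `α * (α * + 1)`, the form to which `α ^ℤ 2`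
    -- unfolds.
    lemma : ∀ α β γ a b p m → p * (α * α) ≡
      (α * (α * + 1) * a + β * b) * (α * (α * + 1) * a + β * b) + m * (b * b) +
      α * α * (p - (α * (α * + 1) * (a * (a * + 1)) + + 2 * β * a * b + γ * (b * (b * + 1)))) +
      - (b * b) * (m - (α * (α * + 1) * γ - β * (β * + 1)))
    lemma = solve-∀
  b≢0 : b ≢ 0ℤ
  b≢0 b≡0 = prime-nonsquare p-prime (α * a) (sym (trans p≡ (trans
    (cong (λ b → (α ^ℤ 2) * (a ^ℤ 2) + (+ 2) * β * a * b + γ * (b ^ℤ 2)) b≡0) (lemma α β γ a))))
    where
    lemma : ∀ α β γ a → α * (α * + 1) * (a * (a * + 1)) + + 2 * β * a * + 0 + γ * + 0 ≡ α * a * (α * a)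
    lemma = solve-∀
  no-points : IsPrime m → m ≡ (+ 1) [mod (+ 8) ] → IsPrime α → α ≡ (+ 3) [mod (+ 4) ] →
              (P : ℚ³) → QuarticEquation p m P → P ≡ 0ℚ³
  no-points (mₙ , m-prime , refl) 8∣m-1 (αₙ , α-prime , refl) 4∣α-3 = quartic-trivial p mₙ
    (no-solution α-prime p-prime m-prime 4∣α+1 μ m≡8μ+1 A b pα²≡ α∤b)
    where
    instance _ = prime⇒nonZero m-prime
    4∣α+1 : + 4 ∣ α + + 1
    4∣α+1 = ∣-combine (+ 1) (+ 1) (∣ᵤ⇒∣ {+ 4} {α - + 3} 4∣α-3) (∣-refl {+ 4}) (lemma α)
      where
      lemma : ∀ α → α + + 1 ≡ + 1 * (α - + 3) + + 1 * + 4
      lemma = solve-∀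
    8∣m-1′ : + 8 ∣ m - + 1
    8∣m-1′ = ∣ᵤ⇒∣ 8∣m-1
    μ : ℤ
    μ = quotient 8∣m-1′
    m≡8μ+1 : m ≡ + 8 * μ + + 1
    m≡8μ+1 = modulo (+ 1) (_∣_.equality 8∣m-1′) (lemma m μ)
      where
      lemma : ∀ m μ → m ≡ + 8 * μ + + 1 + + 1 * (m - + 1 - μ * + 8)
      lemma = solve-∀
    -- If `α` divides `b`, it divides `p`, so p = α ≡ 3 (mod 4), which `p≢3` excludes.
    α∤b : ¬ α ∣ b
    α∤b α∣b = p≢3 α-prime p-prime m-prime 4∣α+1 μ m≡8μ+1 A b pα²≡
      (subst (λ r → + 4 ∣ + r + + 1) (prime-∣-prime α-prime p-prime α∣p) 4∣α+1)
      where
      lemma : ∀ α β γ a b → α * (α * + 1) * (a * (a * + 1)) + + 2 * β * a * b + γ * (b * (b * + 1)) ≡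
              α * a * a * α + (+ 2 * β * a + γ * b) * b
      lemma = solve-∀
      α∣p : α ∣ p
      α∣p = ∣-combine (α * a * a) (+ 2 * β * a + γ * b) ∣-refl α∣b (trans p≡ (lemma α β γ a b))
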